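{- Let $n,b$ be integers with $1<n<b$, let $p=(d_k,\ldots,d_0)_b=n\cdot(d_{\sigma(k)},\ldots,d_{\sigma(0)})_b$ be an $(n,b,\sigma)$-permutiple with carries $c_k,\ldots,c_1,c_0=0$, and let $S=\bigl((c_0,c_1),\ldots,(c_{k-1},c_k),(c_k,c_0)\bigr)$ be its state-transition sequence. Let $\varphi$ be a symmetry of $p$ which fixes $S$, and let $\psi$ be the $(k+1)$-cycle $(0,1,\ldots,k)$. (a) If $0\le j\le k$ and $c_j=0$ (so that $p_{\psi^j}$ is a rotational sibling of $p$), then $\varphi\psi^j$ is also a symmetry of $p$; in particular $(d_{\varphi\psi^j(k)},\ldots,d_{\varphi\psi^j(0)})_b=n\cdot(d_{\sigma\varphi\psi^j(k)},\ldots,d_{\sigma\varphi\psi^j(0)})_b$ is an $(n,b,\psi^{ -j}\varphi^{ -1}\sigma\varphi\psi^j)$-permutiple. (b) If $0<j\le k$ and $c_j=n-1$ (so that $\overline{p}_{\psi^j}$ is a reflective sibling of $p$), then $(\overline{d}_{\varphi\psi^j(k)},\ldots,\overline{d}_{\varphi\psi^j(0)})_b=n\cdot(\overline{d}_{\sigma\varphi\psi^j(k)},\ldots,\overline{d}_{\sigma\varphi\psi^j(0)})_b$, i.e. this number is an $(n,b,\psi^{ -j}\varphi^{ -1}\sigma\varphi\psi^j)$-permutiple.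
   Context: For digits $0\le e_i<b$, $(e_k,\ldots,e_0)_b=\sum_ie_ib^i$ (leading zero digits allowed). For a permutation $\tau$ of $\{0,\ldots,k\}$, $(e_k,\ldots,e_0)_b$ is an $(n,b,\tau)$-permutiple if $(e_k,\ldots,e_0)_b=n\cdot(e_{\tau(k)},\ldots,e_{\tau(0)})_b$. The carries of $p$ are $c_0=0$, $c_{i+1}=\lfloor (nd_{\sigma(i)}+c_i)/b\rfloor$ for $0\le i\le k$ (so $c_{k+1}=0$ and $n d_{\sigma(i)}-d_i+c_i=bc_{i+1}$). The permutiple string of $p$ is $s=(d_0,d_{\sigma(0)})\cdots(d_k,d_{\sigma(k)})$. A permutation $\varphi$ of $\{0,\ldots,k\}$ is a symmetry of $p$ if $(d_{\varphi(k)},\ldots,d_{\varphi(0)})_b=n\cdot(d_{\sigma\varphi(k)},\ldots,d_{\sigma\varphi(0)})_b$ (reordering the inputs of $s$ by $\varphi$ yields another permutiple string). A symmetry $\varphi$ fixes $S$ if $S_\varphi=S$, where $S_\varphi=\bigl((c_{\varphi(0)},c_{\varphi(1)}),\ldots,(c_{\varphi(k-1)},c_{\varphi(k)}),(c_{\varphi(k)},c_{\varphi(0)})\bigr)$ is the state-transition (carry) sequence of the reordered string. $\psi(i)=i+1$ for $i<k$, $\psi(k)=0$. For a digit $d$, $\overline d=b-1-d$. The rotational sibling $p_{\psi^j}$ (for $c_j=0$) is $(d_{\psi^j(k)},\ldots,d_{\psi^j(0)})_b=n\cdot(d_{\sigma\psi^j(k)},\ldots,d_{\sigma\psi^j(0)})_b$,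 and the reflective sibling $\overline{p}_{\psi^j}$ (for $c_j=n-1$) is $(\overline d_{\psi^j(k)},\ldots,\overline d_{\psi^j(0)})_b=n\cdot(\overline d_{\sigma\psi^j(k)},\ldots,\overline d_{\sigma\psi^j(0)})_b$. -}

module Defs where

open import Algebra.Properties.Monoid.Sum using (sum)
open import Data.Digit using (Digit)
open import Data.Fin.Base using (Fin; zero; suc; toℕ; fromℕ; inject₁; opposite)
open import Data.Fin.Permutation as Perm using (Permutation′; permutation; _⟨$⟩ʳ_)
open import Data.Fin.Relation.Unary.Top using (view; ‵fromℕ; ‵inject₁; view-fromℕ; view-inject₁)
open import Data.Nat.Base using (ℕ; zero; suc; _+_; _*_; _^_; _/_; NonZero)
open import Data.Nat.Properties using (+-0-monoid)
open import Data.Product.Base using (_×_; _,_)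
open import Data.Vec.Base using (Vec; tabulate)
open import Data.Vec.Functional using (Vector)
open import Function.Base using (_∘_)
open import Relation.Binary.PropositionalEquality.Core using (_≡_; refl)

-- Composition of permutations, the right factor being applied first
-- (the opposite order to the library's _∘ₚ_).

infixr 9 _∙_

_∙_ : ∀ {m} → Permutation′ m → Permutation′ m → Permutation′ m
π ∙ ρ = ρ Perm.∘ₚ π

infixr 10 _⋆_

_⋆_ : ∀ {m} → Permutation′ m → ℕ → Permutation′ m
π ⋆ zero  = Perm.id
π ⋆ suc j = π ∙ (π ⋆ j)

infix 11 _⁻¹

_⁻¹ : ∀ {m} → Permutation′ m → Permutation′ m
_⁻¹ = Perm.flip

-- The cycle (0 1 … k): i ↦ i + 1 for i < k, and k ↦ 0.

ψ : ∀ {k} → Permutation′ (suc k)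
ψ {k} = permutation to from to-from from-to
  where
  to : Fin (suc k) → Fin (suc k)
  to i with view i
  ... | ‵fromℕ     = zero
  ... | ‵inject₁ j = suc j

  from : Fin (suc k) → Fin (suc k)
  from zero    = fromℕ k
  from (suc j) = inject₁ j

  to-from : ∀ i → to (from i) ≡ i
  to-from zero    rewrite view-fromℕ k   = refl
  to-from (suc j) rewrite view-inject₁ j = refl

  from-to : ∀ i → from (to i) ≡ i
  from-to i with view i
  ... | ‵fromℕ     = refl
  ... | ‵inject₁ j = refl

-- Digit strings are indexed by place value: e i is the coefficient of bⁱ.

⟦_⟧ : ∀ {b m} → Vector (Digit b) m → ℕ
⟦_⟧ {b} e = sum +-0-monoid (λ i → toℕ (e i) * b ^ toℕ i)

-- `opposite` sends a base-b digit d to b − 1 − d.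

complement : ∀ {b m} → Vector (Digit b) m → Vector (Digit b) m
complement d = opposite ∘ d

IsPermutiple : ∀ (n b : ℕ) {m} → Permutation′ m → Vector (Digit b) m → Set
IsPermutiple n b τ e = ⟦ e ⟧ ≡ n * ⟦ e ∘ (τ ⟨$⟩ʳ_) ⟧

IsSymmetry : ∀ (n b : ℕ) {m} → Permutation′ m → Vector (Digit b) m → Permutation′ m → Set
IsSymmetry n b σ d φ = ⟦ d ∘ (φ ⟨$⟩ʳ_) ⟧ ≡ n * ⟦ d ∘ (σ ∙ φ ⟨$⟩ʳ_) ⟧

-- For m digits there are m + 1 carries c₀, …, cₘ; the recurrence determines
-- them uniquely.

record IsCarries (n b : ℕ) .{{_ : NonZero b}} {m} (σ : Permutation′ m)
                 (d : Vector (Digit b) m) (c : Vector ℕ (suc m)) : Set where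
  field
    initial : c zero ≡ 0
    step    : ∀ i → c (suc i) ≡ (n * toℕ (d (σ ⟨$⟩ʳ i)) + c (inject₁ i)) / b

-- The carries are restricted here to c₀, …, cₖ, so that the last
-- transition is (cₖ , c₀).

transitions : ∀ {k} → Vector ℕ (suc k) → Vec (ℕ × ℕ) (suc k)
transitions c = tabulate (λ i → c i , c (ψ ⟨$⟩ʳ i))

-- S_φ = S, where S_φ = ((c_φ(0) , c_φ(1)) , … , (c_φ(k) , c_φ(0))).

Fixes : ∀ {k} → Permutation′ (suc k) → Vector ℕ (suc k) → Set
Fixes φ c = transitions (c ∘ (φ ⟨$⟩ʳ_)) ≡ transitions c

{-# OPTIONS --safe #-}
-- With carries E read cyclically, a permutiple satisfies
-- n d_σ(i) + Eᵢ = dᵢ + b E_ψ(i) for every i, and conversely these equations with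
-- E₀ = 0 give a permutiple.  Modulo b they determine Eᵢ < n < b from the digit pair
-- alone, so the carries of the string reordered by φ are c ∘ φ, which is c because
-- φ fixes S.  The cyclic equations for (d ∘ φ , c) survive rotation, and also
-- complementation together with E ↦ n − 1 − E; the hypothesis on c_j makes the
-- initial carry zero.
module Submission where

open import Defs
open import Algebra.Properties.Semiring.Sum using (*-distribˡ-sum)
open import Data.Digit using (Digit)
open import Data.Fin.Base using (Fin; zero; suc; toℕ; fromℕ; inject₁; opposite)
open import Data.Fin.Induction using (<-weakInduction)
open import Data.Fin.Permutation using (Permutation′; _⟨$⟩ʳ_; inverseʳ)
open import Data.Fin.Properties using (toℕ-inject₁; toℕ<n; opposite-prop)
open import Data.Fin.Relation.Unary.Top using (view; ‵fromℕ; ‵inject₁; view-fromℕ; view-inject₁)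
open import Data.Nat.Base using (ℕ; zero; suc; _+_; _*_; _^_; _∸_; _/_; _%_; _≤_; _<_; NonZero; z<s)
open import Data.Nat.DivMod using ([m+kn]%n≡m%n; m<n⇒m%n≡m; m≡m%n+[m/n]*n; m%n<n; m<n*o⇒m/o<n)
open import Data.Nat.Properties
open import Data.Nat.Tactic.RingSolver using (solve; solve-∀)
open import Data.List.Base using ([]; _∷_)
open import Data.Product.Base using (_×_; _,_; proj₁; proj₂)
open import Data.Vec.Base using (lookup)
open import Data.Vec.Functional using (Vector)
open import Data.Vec.Properties using (lookup∘tabulate)
open import Algebra.Properties.Monoid.Sum +-0-monoid using (sum; sum-cong-≗)
open import Function.Base using (_∘_)
open import Relation.Binary.PropositionalEquality.Core using (_≡_; _≗_; refl; sym; trans; cong; cong₂; subst)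
open import Relation.Binary.PropositionalEquality.Properties using (module ≡-Reasoning)

-- Values of digit strings and residues modulo the base.

⟦⟧-cong : ∀ {b m} {x y : Vector (Digit b) m} → x ≗ y → ⟦ x ⟧ ≡ ⟦ y ⟧
⟦⟧-cong {b} x≗y = sum-cong-≗ (λ i → cong (λ e → toℕ e * b ^ toℕ i) (x≗y i))

⟦⟧-suc : ∀ {b m} (x : Vector (Digit b) (suc m)) → ⟦ x ⟧ ≡ toℕ (x zero) + b * ⟦ x ∘ suc ⟧
⟦⟧-suc {b} x = cong₂ _+_ (*-identityʳ _) (begin
  sum (λ i → toℕ (x (suc i)) * (b * b ^ toℕ i))   ≡⟨ sum-cong-≗ (λ i → swap (toℕ (x (suc i))) (b ^ toℕ i)) ⟩
  sum (λ i → b * (toℕ (x (suc i)) * b ^ toℕ i))   ≡⟨ *-distribˡ-sum +-*-semiring b (λ i → toℕ (x (suc i)) * b ^ toℕ i) ⟨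
  b * ⟦ x ∘ suc ⟧                                 ∎)
  where
  open ≡-Reasoning
  swap : ∀ u v → u * (b * v) ≡ b * (u * v)
  swap u v = solve (u ∷ b ∷ v ∷ [])

mod-unique : ∀ {b r s} .{{_ : NonZero b}} u v → r < b → s < b → r + u * b ≡ s + v * b → r ≡ s
mod-unique {b} {r} {s} u v r<b s<b eq = begin
  r                 ≡⟨ m<n⇒m%n≡m r<b ⟨
  r % b             ≡⟨ [m+kn]%n≡m%n r u b ⟨
  (r + u * b) % b   ≡⟨ cong (_% b) eq ⟩
  (s + v * b) % b   ≡⟨ [m+kn]%n≡m%n s v b ⟩
  s % b             ≡⟨ m<n⇒m%n≡m s<b ⟩
  s                 ∎
  where open ≡-Reasoning

-- Carries and the digitwise equations of a multiplication by `n`.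

module _ {b : ℕ} (n : ℕ) where

  -- The digits being multiplied form a vector `y` of their own, not `d` composed with a
  -- permutation, so that inductions can drop the lowest digit.
  Recurrence : .{{_ : NonZero b}} → ∀ {m} → Vector (Digit b) m → Vector ℕ (suc m) → Set
  Recurrence y c = ∀ i → c (suc i) ≡ (n * toℕ (y i) + c (inject₁ i)) / b

  Steps : ∀ {m} → Vector (Digit b) m → Vector (Digit b) m → Vector ℕ (suc m) → Set
  Steps x y c = ∀ i → n * toℕ (y i) + c (inject₁ i) ≡ toℕ (x i) + b * c (suc i)

  Cyclic : ∀ {k} → Vector (Digit b) (suc k) → Vector (Digit b) (suc k) → Vector ℕ (suc k) → Set
  Cyclic x y E = ∀ i → n * toℕ (y i) + E i ≡ toℕ (x i) + b * E (ψ ⟨$⟩ʳ i)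

  -- The incoming carry `a` is arbitrary because the recursion hands the first quotient on to the
  -- remaining digits.
  carries : .{{_ : NonZero b}} → ∀ {m} → Vector (Digit b) m → ℕ → Vector ℕ (suc m)
  carries         y a zero    = a
  carries {suc m} y a (suc i) = carries (y ∘ suc) ((n * toℕ (y zero) + a) / b) i

  carries-recurrence : .{{_ : NonZero b}} → ∀ {m} (y : Vector (Digit b) m) a → Recurrence y (carries y a)
  carries-recurrence y a zero    = refl
  carries-recurrence y a (suc i) = carries-recurrence (y ∘ suc) _ i

  recurrence-bounded : .{{_ : NonZero b}} → ∀ {m} (y : Vector (Digit b) m) c →
    Recurrence y c → c zero < n → ∀ i → c i < n
  recurrence-bounded y c rec c₀<n = <-weakInduction _ c₀<n next
    where
    next : ∀ i → c (inject₁ i) < n → c (suc i) < n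
    next i cᵢ<n = subst (_< n) (sym (rec i)) (m<n*o⇒m/o<n (begin-strict
      n * toℕ (y i) + c (inject₁ i)   <⟨ +-monoʳ-< (n * toℕ (y i)) cᵢ<n ⟩
      n * toℕ (y i) + n               ≡⟨ trans (*-suc n _) (+-comm n _) ⟨
      n * suc (toℕ (y i))             ≤⟨ *-monoʳ-≤ n (toℕ<n (y i)) ⟩
      n * b                           ∎))
      where open ≤-Reasoning

  -- Weighting the i-th equation by the i-th power of `b` and summing makes the inner carries
  -- telescope; only the first and the last survive.
  steps⇒value : ∀ {m} (x y : Vector (Digit b) m) c → Steps x y c →
    n * ⟦ y ⟧ + c zero ≡ ⟦ x ⟧ + b ^ m * c (fromℕ m)
  steps⇒value {zero}  x y c steps =
    trans (cong (_+ c zero) (*-zeroʳ n)) (sym (*-identityˡ (c zero)))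
  steps⇒value {suc m} x y c steps
    rewrite ⟦⟧-suc x | ⟦⟧-suc y = begin
      n * (y₀ + b * Y) + c zero                   ≡⟨ regroup y₀ Y (c zero) ⟩
      (n * y₀ + c zero) + b * (n * Y)             ≡⟨ cong (_+ b * (n * Y)) (steps zero) ⟩
      (x₀ + b * c (suc zero)) + b * (n * Y)       ≡⟨ regroup′ x₀ (c (suc zero)) (n * Y) ⟩
      x₀ + b * (n * Y + c (suc zero))             ≡⟨ cong (λ z → x₀ + b * z) (steps⇒value (x ∘ suc) (y ∘ suc) (c ∘ suc) (steps ∘ suc)) ⟩
      x₀ + b * (X + b ^ m * c (fromℕ (suc m)))    ≡⟨ regroup″ x₀ X (b ^ m) (c (fromℕ (suc m))) ⟩
      x₀ + b * X + b * b ^ m * c (fromℕ (suc m))  ∎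
    where
    open ≡-Reasoning
    x₀ = toℕ (x zero)
    y₀ = toℕ (y zero)
    X  = ⟦ x ∘ suc ⟧
    Y  = ⟦ y ∘ suc ⟧
    regroup : ∀ u v w → n * (u + b * v) + w ≡ (n * u + w) + b * (n * v)
    regroup u v w = solve (n ∷ b ∷ u ∷ v ∷ w ∷ [])
    regroup′ : ∀ u v w → (u + b * v) + b * w ≡ u + b * (w + v)
    regroup′ u v w = solve (b ∷ u ∷ v ∷ w ∷ [])
    regroup″ : ∀ u v p w → u + b * (v + p * w) ≡ u + b * v + b * p * w
    regroup″ u v p w = solve (b ∷ u ∷ v ∷ p ∷ w ∷ [])

  -- Reading the equation modulo `b` identifies the lowest digit of `x`; removing that digit and
  -- dividing by `b` leaves the same statement for the higher digits, with `c (suc zero)` as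
  -- incoming carry. When no digits are left, the equation says that the outgoing carry is 0.
  value⇒steps : .{{_ : NonZero b}} → ∀ {m} (x y : Vector (Digit b) m) c → Recurrence y c →
    n * ⟦ y ⟧ + c zero ≡ ⟦ x ⟧ → Steps x y c × c (fromℕ m) ≡ 0
  value⇒steps {zero}  x y c rec eq = (λ ()) , trans (cong (_+ c zero) (sym (*-zeroʳ n))) eq
  value⇒steps {suc m} x y c rec eq rewrite ⟦⟧-suc x | ⟦⟧-suc y =
    (λ { zero → step₀ ; (suc i) → proj₁ rest i }) , proj₂ rest
    where
    open ≡-Reasoning
    x₀ = toℕ (x zero)
    y₀ = toℕ (y zero)
    X  = ⟦ x ∘ suc ⟧
    Y  = ⟦ y ∘ suc ⟧
    t  = n * y₀ + c zero
    q  = t / b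
    regroup : ∀ r p v → r + (p + v) * b ≡ (r + p * b) + b * v
    regroup r p v = solve (b ∷ r ∷ p ∷ v ∷ [])
    regroup′ : ∀ u v w → (n * u + w) + b * (n * v) ≡ n * (u + b * v) + w
    regroup′ u v w = solve (n ∷ b ∷ u ∷ v ∷ w ∷ [])
    regroup″ : ∀ u v w → u + b * (v + w) ≡ (u + b * w) + b * v
    regroup″ u v w = solve (b ∷ u ∷ v ∷ w ∷ [])
    total : t + b * (n * Y) ≡ x₀ + b * X
    total = trans (regroup′ y₀ Y (c zero)) eq
    remainder : t % b ≡ x₀
    remainder = mod-unique (q + n * Y) X (m%n<n t b) (toℕ<n (x zero)) (begin
      t % b + (q + n * Y) * b         ≡⟨ regroup (t % b) q (n * Y) ⟩
      (t % b + q * b) + b * (n * Y)   ≡⟨ cong (_+ b * (n * Y)) (m≡m%n+[m/n]*n t b) ⟨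
      t + b * (n * Y)                 ≡⟨ total ⟩
      x₀ + b * X                      ≡⟨ cong (x₀ +_) (*-comm b X) ⟩
      x₀ + X * b                      ∎)
    step₀ : t ≡ x₀ + b * c (suc zero)
    step₀ = begin
      t                       ≡⟨ m≡m%n+[m/n]*n t b ⟩
      t % b + q * b           ≡⟨ cong₂ _+_ remainder (*-comm q b) ⟩
      x₀ + b * q              ≡⟨ cong (λ e → x₀ + b * e) (rec zero) ⟨
      x₀ + b * c (suc zero)   ∎
    tail : n * Y + c (suc zero) ≡ X
    tail = *-cancelˡ-≡ _ _ b (+-cancelˡ-≡ x₀ _ _ (begin
      x₀ + b * (n * Y + c (suc zero))         ≡⟨ regroup″ x₀ (n * Y) (c (suc zero)) ⟩
      (x₀ + b * c (suc zero)) + b * (n * Y)   ≡⟨ cong (_+ b * (n * Y)) step₀ ⟨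
      t + b * (n * Y)                         ≡⟨ total ⟩
      x₀ + b * X                              ∎))
    rest = value⇒steps (x ∘ suc) (y ∘ suc) (c ∘ suc) (rec ∘ suc) tail

-- Indices along the cycle `ψ`, and complementation of a single step.

ψ-inject₁ : ∀ {k} (i : Fin k) → ψ ⟨$⟩ʳ inject₁ i ≡ suc i
ψ-inject₁ i rewrite view-inject₁ i = refl

ψ-fromℕ : ∀ k → ψ ⟨$⟩ʳ fromℕ k ≡ zero
ψ-fromℕ k rewrite view-fromℕ k = refl

ψ⋆-zero : ∀ {k} (j : Fin (suc k)) → ψ ⋆ toℕ j ⟨$⟩ʳ zero ≡ j
ψ⋆-zero = <-weakInduction _ refl next
  where
  next : ∀ j → ψ ⋆ toℕ (inject₁ j) ⟨$⟩ʳ zero ≡ inject₁ j → ψ ⋆ toℕ (suc j) ⟨$⟩ʳ zero ≡ suc j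
  next j ih rewrite toℕ-inject₁ j = trans (cong (ψ ⟨$⟩ʳ_) ih) (ψ-inject₁ j)

ψ⋆-comm : ∀ {k} j (i : Fin (suc k)) → ψ ⟨$⟩ʳ (ψ ⋆ j ⟨$⟩ʳ i) ≡ ψ ⋆ j ⟨$⟩ʳ (ψ ⟨$⟩ʳ i)
ψ⋆-comm zero    i = refl
ψ⋆-comm (suc j) i = cong (ψ ⟨$⟩ʳ_) (ψ⋆-comm j i)

-- This passes from linear to cyclic indexing: the two successors differ only at the top index,
-- where `wrap` closes the circle.
suc-ψ : ∀ {k} (c : Vector ℕ (suc (suc k))) → c (fromℕ (suc k)) ≡ c zero →
  ∀ i → c (suc i) ≡ c (inject₁ (ψ ⟨$⟩ʳ i))
suc-ψ c wrap i with view i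
... | ‵fromℕ     = wrap
... | ‵inject₁ j = refl

-- The identity n(b - 1) + (n - 1) = (b - 1) + b(n - 1) minus the given step is the complemented
-- step. Complements are described by sums, which avoids truncated subtraction.
complement-step : ∀ n {b x y c e x̄ ȳ c̄ ē} →
  x̄ + suc x ≡ b → ȳ + suc y ≡ b → c̄ + suc c ≡ n → ē + suc e ≡ n →
  n * y + c ≡ x + b * e → n * ȳ + c̄ ≡ x̄ + b * ē
complement-step n {b} {x} {y} {c} {e} {x̄} {ȳ} {c̄} {ē} x+x̄ y+ȳ c+c̄ e+ē step =
  -- Besides one side of the given step, the padding holds the units needed to complete every
  -- complement pair: `n` and 1 on the left, `b` and 1 on the right.
  +-cancelʳ-≡ (suc (x + b * e) + b + n) _ _ (begin
    (n * ȳ + c̄) + (suc (x + b * e) + b + n)   ≡⟨ cong (λ z → (n * ȳ + c̄) + (suc z + b + n)) step ⟨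
    (n * ȳ + c̄) + (suc (n * y + c) + b + n)   ≡⟨ regroup n y ȳ c c̄ b ⟩
    n * (ȳ + suc y) + (c̄ + suc c) + b         ≡⟨ cong₂ (λ u v → n * u + v + b) y+ȳ c+c̄ ⟩
    n * b + n + b                             ≡⟨ regroup″ n b ⟩
    b + b * n + n                             ≡⟨ cong₂ (λ u v → u + b * v + n) x+x̄ e+ē ⟨
    (x̄ + suc x) + b * (ē + suc e) + n         ≡⟨ regroup′ b x x̄ e ē n ⟩
    (x̄ + b * ē) + (suc (x + b * e) + b + n)   ∎)
  where
  open ≡-Reasoning
  regroup : ∀ n y ȳ c c̄ b → (n * ȳ + c̄) + (suc (n * y + c) + b + n) ≡ n * (ȳ + suc y) + (c̄ + suc c) + b
  regroup = solve-∀
  regroup′ : ∀ b x x̄ e ē n → (x̄ + suc x) + b * (ē + suc e) + n ≡ (x̄ + b * ē) + (suc (x + b * e) + b + n)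
  regroup′ = solve-∀
  regroup″ : ∀ n b → n * b + n + b ≡ b + b * n + n
  regroup″ = solve-∀

-- Cyclic carry equations: link with values, rotation, complementation, uniqueness.

module _ {b : ℕ} (n : ℕ) where

  steps⇒cyclic : ∀ {k} (x y : Vector (Digit b) (suc k)) c →
    Steps n x y c → c (fromℕ (suc k)) ≡ c zero → Cyclic n x y (c ∘ inject₁)
  steps⇒cyclic x y c steps wrap i =
    trans (steps i) (cong (λ e → toℕ (x i) + b * e) (suc-ψ c wrap i))

  value⇒cyclic : .{{_ : NonZero b}} → ∀ {k} (x y : Vector (Digit b) (suc k)) c →
    Recurrence n y c → c zero ≡ 0 → ⟦ x ⟧ ≡ n * ⟦ y ⟧ → Cyclic n x y (c ∘ inject₁)
  value⇒cyclic x y c rec c₀≡0 eq =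
    steps⇒cyclic x y c (proj₁ steps) (trans (proj₂ steps) (sym c₀≡0))
    where
    steps = value⇒steps n x y c rec
      (trans (cong (n * ⟦ y ⟧ +_) c₀≡0) (trans (+-identityʳ _) (sym eq)))

  cyclic⇒value : ∀ {k} (x y : Vector (Digit b) (suc k)) E →
    Cyclic n x y E → E zero ≡ 0 → ⟦ x ⟧ ≡ n * ⟦ y ⟧
  cyclic⇒value {k} x y E cyc E₀≡0 = begin
    ⟦ x ⟧                                   ≡⟨ +-identityʳ _ ⟨
    ⟦ x ⟧ + 0                               ≡⟨ cong (⟦ x ⟧ +_) (*-zeroʳ (b ^ suc k)) ⟨
    ⟦ x ⟧ + b ^ suc k * 0                   ≡⟨ cong (λ e → ⟦ x ⟧ + b ^ suc k * e) last≡0 ⟨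
    ⟦ x ⟧ + b ^ suc k * c (fromℕ (suc k))   ≡⟨ steps⇒value n x y c steps ⟨
    n * ⟦ y ⟧ + E zero                      ≡⟨ cong (n * ⟦ y ⟧ +_) E₀≡0 ⟩
    n * ⟦ y ⟧ + 0                           ≡⟨ +-identityʳ _ ⟩
    n * ⟦ y ⟧                               ∎
    where
    open ≡-Reasoning
    -- Walking along the cycle from `zero` lists all of `E`, and one further step returns to
    -- `E zero`, which is the final carry and vanishes.
    c : Vector ℕ (suc (suc k))
    c i = E (ψ ⋆ toℕ i ⟨$⟩ʳ zero)
    last≡0 : c (fromℕ (suc k)) ≡ 0
    last≡0 = trans (cong E (trans (cong (ψ ⟨$⟩ʳ_) (ψ⋆-zero (fromℕ k))) (ψ-fromℕ k))) E₀≡0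
    steps : Steps n x y c
    steps i rewrite toℕ-inject₁ i | ψ⋆-zero i = cyc i

  cyclic-rotate : ∀ {k} (x y : Vector (Digit b) (suc k)) E j → Cyclic n x y E →
    Cyclic n (x ∘ (ψ ⋆ j ⟨$⟩ʳ_)) (y ∘ (ψ ⋆ j ⟨$⟩ʳ_)) (E ∘ (ψ ⋆ j ⟨$⟩ʳ_))
  cyclic-rotate x y E j cyc i =
    trans (cyc (ψ ⋆ j ⟨$⟩ʳ i)) (cong (λ i′ → toℕ (x (ψ ⋆ j ⟨$⟩ʳ i)) + b * E i′) (ψ⋆-comm j i))

  -- The bound on `E` makes the truncated difference a genuine n - 1 - E.
  cyclic-complement : ∀ {k} (x y : Vector (Digit b) (suc k)) E → (∀ i → E i < n) →
    Cyclic n x y E → Cyclic n (complement x) (complement y) (λ i → n ∸ suc (E i))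
  cyclic-complement x y E E<n cyc i =
    complement-step n (opposite-sum (x i)) (opposite-sum (y i))
      (m∸n+n≡m (E<n i)) (m∸n+n≡m (E<n (ψ ⟨$⟩ʳ i))) (cyc i)
    where
    opposite-sum : (e : Digit b) → toℕ (opposite e) + suc (toℕ e) ≡ b
    opposite-sum e = trans (cong (_+ suc (toℕ e)) (opposite-prop e)) (m∸n+n≡m (toℕ<n e))

  -- The outgoing carries `e` and `e′` may differ a priori, but they enter only as multiples of `b`,
  -- so `c` and `c′` are congruent modulo `b`, and both are below `b`.
  step-unique : .{{_ : NonZero b}} → n < b → ∀ x y {c c′ e e′} → c < n → c′ < n →
    n * y + c ≡ x + b * e → n * y + c′ ≡ x + b * e′ → c ≡ c′
  step-unique n<b x y {c} {c′} {e} {e′} c<n c′<n step step′ =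
    mod-unique e′ e (<-trans c<n n<b) (<-trans c′<n n<b)
      (+-cancelˡ-≡ (n * y + x) _ _ (begin
        (n * y + x) + (c + e′ * b)      ≡⟨ regroup n y x c e′ b ⟩
        (n * y + c) + (x + b * e′)      ≡⟨ cong₂ _+_ step (sym step′) ⟩
        (x + b * e) + (n * y + c′)      ≡⟨ +-comm (x + b * e) _ ⟩
        (n * y + c′) + (x + b * e)      ≡⟨ regroup n y x c′ e b ⟨
        (n * y + x) + (c′ + e * b)      ∎))
    where
    open ≡-Reasoning
    regroup : ∀ n y x c e b → (n * y + x) + (c + e * b) ≡ (n * y + c) + (x + b * e)
    regroup = solve-∀

-- The string reordered by a symmetry that fixes the transitions.

fixes-carry : ∀ {k} (φ : Permutation′ (suc k)) c → Fixes φ c → ∀ i → c (φ ⟨$⟩ʳ i) ≡ c i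
fixes-carry φ c fix i = begin
  c (φ ⟨$⟩ʳ i)                                     ≡⟨ lookup-transitions (c ∘ (φ ⟨$⟩ʳ_)) ⟨
  proj₁ (lookup (transitions (c ∘ (φ ⟨$⟩ʳ_))) i)   ≡⟨ cong (λ v → proj₁ (lookup v i)) fix ⟩
  proj₁ (lookup (transitions c) i)                 ≡⟨ lookup-transitions c ⟩
  c i                                              ∎
  where
  open ≡-Reasoning
  lookup-transitions : ∀ e → proj₁ (lookup (transitions e) i) ≡ e i
  lookup-transitions e = cong proj₁ (lookup∘tabulate (λ i → e i , e (ψ ⟨$⟩ʳ i)) i)

symmetry-cyclic : ∀ {n b} .{{_ : NonZero b}} → 0 < n → n < b →
  ∀ {k} (σ φ : Permutation′ (suc k)) (d : Vector (Digit b) (suc k)) (E : Vector ℕ (suc k)) →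
  (∀ i → E i < n) → Cyclic n d (d ∘ (σ ⟨$⟩ʳ_)) E →
  IsSymmetry n b σ d φ → Fixes φ E →
  Cyclic n (d ∘ (φ ⟨$⟩ʳ_)) (d ∘ (σ ∙ φ ⟨$⟩ʳ_)) E
symmetry-cyclic {n} {b} 0<n n<b {k} σ φ d E E<n cyc sym-φ fix i = begin
  n * toℕ (y i) + E i                                    ≡⟨ cong (n * toℕ (y i) +_) (c≡E i) ⟨
  n * toℕ (y i) + c (inject₁ i)                          ≡⟨ cyc-φ i ⟩
  toℕ (d (φ ⟨$⟩ʳ i)) + b * c (inject₁ (ψ ⟨$⟩ʳ i))        ≡⟨ cong (λ e → toℕ (d (φ ⟨$⟩ʳ i)) + b * e) (c≡E (ψ ⟨$⟩ʳ i)) ⟩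
  toℕ (d (φ ⟨$⟩ʳ i)) + b * E (ψ ⟨$⟩ʳ i)                  ∎
  where
  open ≡-Reasoning
  y : Vector (Digit b) (suc k)
  y = d ∘ (σ ∙ φ ⟨$⟩ʳ_)
  c : Vector ℕ (suc (suc k))
  c = carries n y 0
  cyc-φ : Cyclic n (d ∘ (φ ⟨$⟩ʳ_)) y (c ∘ inject₁)
  cyc-φ = value⇒cyclic n (d ∘ (φ ⟨$⟩ʳ_)) y c (carries-recurrence n y 0) refl sym-φ
  -- The carry computed afresh at `i` and the original one at `φ ⟨$⟩ʳ i` go with the same digit
  -- pair; `fix` then brings the index back to `i`.
  c≡E : ∀ i → c (inject₁ i) ≡ E i
  c≡E i = trans
    (step-unique n n<b (toℕ (d (φ ⟨$⟩ʳ i))) (toℕ (y i))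
      (recurrence-bounded n y c (carries-recurrence n y 0) 0<n (inject₁ i))
      (E<n (φ ⟨$⟩ʳ i)) (cyc-φ i) (cyc (φ ⟨$⟩ʳ i)))
    (fixes-carry φ E fix i)

-- Precomposing the conjugate with `φ ∙ π` cancels the inverses and leaves `σ ∙ φ ∙ π`. As `d` is
-- arbitrary, this covers complemented digits too.
conjugate-permutiple : ∀ n {b k} (σ φ π : Permutation′ (suc k)) (d : Vector (Digit b) (suc k)) →
  IsSymmetry n b σ d (φ ∙ π) →
  IsPermutiple n b (π ⁻¹ ∙ φ ⁻¹ ∙ σ ∙ φ ∙ π) (d ∘ (φ ∙ π ⟨$⟩ʳ_))
conjugate-permutiple n σ φ π d eq = trans eq (cong (n *_) (⟦⟧-cong
  {x = d ∘ (σ ∙ φ ∙ π ⟨$⟩ʳ_)}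
  {y = d ∘ (φ ∙ π ∙ π ⁻¹ ∙ φ ⁻¹ ∙ σ ∙ φ ∙ π ⟨$⟩ʳ_)}
  (λ i → cong d (sym (trans (cong (φ ⟨$⟩ʳ_) (inverseʳ π)) (inverseʳ φ))))))

theorem26 : (n b : ℕ) .{{_ : NonZero b}} → 1 < n → n < b →
    (k : ℕ) (σ : Permutation′ (suc k)) (d : Vector (Digit b) (suc k)) →
    IsPermutiple n b σ d →
    (c : Vector ℕ (suc (suc k))) → IsCarries n b σ d c →
    (φ : Permutation′ (suc k)) → IsSymmetry n b σ d φ → Fixes φ (c ∘ inject₁) →
    ((j : Fin (suc k)) → c (inject₁ j) ≡ 0 →
    IsSymmetry n b σ d (φ ∙ ψ ⋆ toℕ j)
    × IsPermutiple n b ((ψ ⋆ toℕ j) ⁻¹ ∙ φ ⁻¹ ∙ σ ∙ φ ∙ ψ ⋆ toℕ j)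
    (d ∘ (φ ∙ ψ ⋆ toℕ j ⟨$⟩ʳ_)))
    × ((j : Fin (suc k)) → 0 < toℕ j → c (inject₁ j) ≡ n ∸ 1 →
    (⟦ complement d ∘ (φ ∙ ψ ⋆ toℕ j ⟨$⟩ʳ_) ⟧
    ≡ n * ⟦ complement d ∘ (σ ∙ φ ∙ ψ ⋆ toℕ j ⟨$⟩ʳ_) ⟧)
    × IsPermutiple n b ((ψ ⋆ toℕ j) ⁻¹ ∙ φ ⁻¹ ∙ σ ∙ φ ∙ ψ ⋆ toℕ j)
    (complement d ∘ (φ ∙ ψ ⋆ toℕ j ⟨$⟩ʳ_)))
theorem26 n b 1<n n<b k σ d perm c isC φ sym-φ fix = rotational , reflective
  where
  C : Vector ℕ (suc k)
  C = c ∘ inject₁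
  x y : Vector (Digit b) (suc k)
  x = d ∘ (φ ⟨$⟩ʳ_)
  y = d ∘ (σ ∙ φ ⟨$⟩ʳ_)
  0<n : 0 < n
  0<n = <-trans z<s 1<n
  C<n : ∀ i → C i < n
  C<n i = recurrence-bounded n (d ∘ (σ ⟨$⟩ʳ_)) c (IsCarries.step isC)
    (subst (_< n) (sym (IsCarries.initial isC)) 0<n) (inject₁ i)
  cyc : Cyclic n x y C
  cyc = symmetry-cyclic 0<n n<b σ φ d C C<n
    (value⇒cyclic n d (d ∘ (σ ⟨$⟩ʳ_)) c (IsCarries.step isC) (IsCarries.initial isC) perm) sym-φ fix
  rotational : (j : Fin (suc k)) → C j ≡ 0 → _
  rotational j cⱼ≡0 = symmetry , conjugate-permutiple n σ φ (ψ ⋆ toℕ j) d symmetry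
    where
    symmetry : IsSymmetry n b σ d (φ ∙ ψ ⋆ toℕ j)
    -- Rotation by `j` moves the carry at `j`, which is 0, to the initial place.
    symmetry = cyclic⇒value n _ _ _ (cyclic-rotate n x y C (toℕ j) cyc)
      (trans (cong C (ψ⋆-zero j)) cⱼ≡0)
  reflective : (j : Fin (suc k)) → 0 < toℕ j → C j ≡ n ∸ 1 → _
  reflective j _ cⱼ≡n∸1 = symmetry , conjugate-permutiple n σ φ (ψ ⋆ toℕ j) (complement d) symmetry
    where
    C̄ : Vector ℕ (suc k)
    C̄ i = n ∸ suc (C i)
    symmetry : IsSymmetry n b σ (complement d) (φ ∙ ψ ⋆ toℕ j)
    -- Complementing comes first and turns the carry n - 1 at `j` into 0; the rotation then makes it
    -- the initial carry.
    symmetry = cyclic⇒value n _ _ _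
      (cyclic-rotate n (complement x) (complement y) C̄ (toℕ j) (cyclic-complement n x y C C<n cyc))
      (trans (cong C̄ (ψ⋆-zero j))
        (m≤n⇒m∸n≡0 (subst (λ e → n ≤ suc e) (sym cⱼ≡n∸1) (m≤n+m∸n n 1))))
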